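{- Let $G$ be a finite simple cubic (3-regular) graph that has no subgraph (not necessarily induced) isomorphic to the graph $L$. Then the vertex set of $G$ can be partitioned into two total dominating sets of $G$; equivalently, the total domatic number of $G$ (its coupon coloring number) is at least $2$.
   Context: All graphs are simple. A set $T\subseteq V(G)$ is a total dominating set of $G$ if every vertex $v\in V(G)$ is adjacent to at least one vertex of $T$. The total domatic number $d_t(G)$ is the maximum number of total dominating sets into which $V(G)$ can be partitioned; a $k$-coupon coloring is an assignment of colors $\{1,\dots,k\}$ to $V(G)$ such that the open neighborhood of every vertex contains all $k$ colors, and the coupon coloring number is the largest such $k$. The graph $L$ is the tree on $10$ vertices consisting of a root $r$ adjacent to three vertices $x_1,x_2,x_3$, where each $x_i$ is adjacent to two further leaves (the six leaves being distinct), i.e. the tree of depth $2$ in which the root has three children and each child has two children. -}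

module Defs where

open import Data.Nat using (ℕ)
open import Data.Fin using (Fin; zero; suc)
open import Data.Product using (Σ; _×_; _,_; ∃)
open import Data.Sum using (_⊎_)
open import Relation.Binary.PropositionalEquality using (_≡_; _≢_)
open import Relation.Nullary using (¬_)
open import Function.Definitions using (Injective)
open import Level using (0ℓ)

record Graph (n : ℕ) : Set₁ where
  field
    Adj     : Fin n → Fin n → Set
    sym     : ∀ {u v} → Adj u v → Adj v u
    irrefl  : ∀ {v} → ¬ Adj v v

open Graph public

Cubic : ∀ {n} → Graph n → Set
Cubic {n} G = (v : Fin n) → Σ (Fin n) λ a → Σ (Fin n) λ b → Σ (Fin n) λ c →
    Adj G v a × Adj G v b × Adj G v c × a ≢ b × a ≢ c × b ≢ c
  × ((w : Fin n) → Adj G v w → (w ≡ a) ⊎ (w ≡ b) ⊎ (w ≡ c))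

-- The tree L on 10 vertices: root r = 0, children x1 = 1, x2 = 2, x3 = 3;
-- leaves 4,5 under x1; 6,7 under x2; 8,9 under x3.
-- LEdge i j : the (ordered) edge list of L, parent then child.
data LEdge : Fin 10 → Fin 10 → Set where
  r-x1  : LEdge zero (suc zero)
  r-x2  : LEdge zero (suc (suc zero))
  r-x3  : LEdge zero (suc (suc (suc zero)))
  x1-l1 : LEdge (suc zero) (suc (suc (suc (suc zero))))
  x1-l2 : LEdge (suc zero) (suc (suc (suc (suc (suc zero)))))
  x2-l3 : LEdge (suc (suc zero)) (suc (suc (suc (suc (suc (suc zero))))))
  x2-l4 : LEdge (suc (suc zero)) (suc (suc (suc (suc (suc (suc (suc zero)))))))
  x3-l5 : LEdge (suc (suc (suc zero))) (suc (suc (suc (suc (suc (suc (suc (suc zero))))))))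
  x3-l6 : LEdge (suc (suc (suc zero))) (suc (suc (suc (suc (suc (suc (suc (suc (suc zero)))))))))

ContainsL : ∀ {n} → Graph n → Set
ContainsL {n} G = Σ (Fin 10 → Fin n) λ f →
  Injective _≡_ _≡_ f × (∀ {i j} → LEdge i j → Adj G (f i) (f j))

TotalDominating : ∀ {n} → Graph n → (Fin n → Set) → Set
TotalDominating {n} G T = (v : Fin n) → Σ (Fin n) λ u → Adj G v u × T u

PartitionIntoTwoTDS : ∀ {n} → Graph n → Set
PartitionIntoTwoTDS {n} G = Σ (Fin n → Fin 2) λ part →
  (k : Fin 2) → TotalDominating G (λ v → part v ≡ k)

{-# OPTIONS --safe #-}

-- A cubic graph is L-free iff every vertex lies on a triangle or a 4-cycle. A colouring is
-- wanted in which no open neighbourhood N(u) ("clause") is monochromatic.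
--
-- Seymour's sign trick: if an integer vector x supported on the uncoloured vertices satisfies
-- Σ_{z ∈ N(u)} x z = 0 for every entirely uncoloured N(u), then colouring by the signs of x
-- makes each of those clauses bichromatic or leaves it untouched. A nonzero x exists as soon as
-- there are fewer uncoloured clauses than uncoloured vertices. By double counting of incidences
-- this holds unless every clause is entirely coloured or entirely uncoloured. In that tight case
-- an uncoloured 4-cycle v u₁ w u₂ still helps: the clauses of u₁ and u₂, which both contain v
-- and w, are traded for the one equation x v + x w = 0.
--
-- Once no 4-cycle meets the uncoloured set, that set is a union of disjoint triangles. A triangle
-- y p q with a coloured outside neighbour y′ of y is completed by giving y the colour of y′ and
-- p, q the other colour; two adjacent triangles, joined by the edge x y, are coloured in the
-- same way with x and y getting equal colours.
module Submission where

open import Data.Nat as ℕ using (ℕ; zero; suc; s≤s; z≤n)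
import Data.Nat.Properties as ℕ
open import Data.Nat.Tactic.RingSolver using () renaming (solve-∀ to solve-∀ᴺ)
open import Data.Integer as ℤ using (ℤ; 0ℤ; 1ℤ; _+_; _*_; -_; _-_; _<_; _<?_) renaming (_≟_ to _≟ᶻ_)
import Data.Integer.Properties as ℤ
open import Data.Integer.Tactic.RingSolver using (solve-∀)
open import Data.Bool using (true; false; if_then_else_)
open import Data.Fin using (Fin; zero; suc; punchIn; _≟_)
open import Data.Fin.Properties using (any?; punchInᵢ≢i)
open import Data.Fin.Patterns using (0F; 1F)
open import Data.List using (List; []; _∷_; _++_; length; map; filter; tabulate; allFin)
open import Data.List.Properties using (length-map; length-++)
open import Data.List.Membership.Propositional.Properties using (∈-filter⁺; ∈-allFin)
open import Data.List.Relation.Unary.All as All using (All; []; _∷_)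
open import Data.List.Relation.Unary.All.Properties using (map⁻; ++⁻)
open import Data.Product using (_×_; _,_; ∃; proj₁; proj₂)
open import Data.Sum using (_⊎_; inj₁; inj₂; [_,_]′)
open import Data.Vec.Functional using (insertAt; removeAt)
open import Data.Vec.Functional.Properties using (insertAt-lookup; insertAt-punchIn)
open import Data.Vec using (_∷_; []; lookup)
open import Data.Vec.Relation.Unary.All using (_∷_; [])
open import Data.Vec.Relation.Unary.AllPairs using (_∷_; [])
open import Data.Vec.Relation.Unary.Unique.Propositional.Properties using (lookup-injective)
open import Function using (_∘_; id)
open import Relation.Binary using (tri<; tri≈; tri>)
open import Relation.Binary.PropositionalEquality
open import Relation.Nullary using (¬_; Dec; yes; no; does; contradiction)
open import Relation.Nullary.Decidable using (¬?; _×-dec_; _⊎-dec_; map′; decidable-stable; dec-true; dec-false)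
open import Relation.Unary using (Pred; Decidable)
open import Algebra.Bundles using (CommutativeMonoid)
import Algebra.Properties.CommutativeMonoid.Sum as Sum
open import Algebra.Properties.AbelianGroup ℤ.+-0-abelianGroup using (inverseʳ-unique)
open import Algebra.Properties.Semiring.Sum ℤ.+-*-semiring as Σℤ using ()
open import Algebra.Properties.Semiring.Sum ℕ.+-*-semiring as Σℕ using (sum)
open import Defs using (Graph; Adj; irrefl; Cubic; ContainsL; LEdge; PartitionIntoTwoTDS)
open LEdge

private
  variable
    n : ℕ

-- Homogeneous integer linear systems.

infix 7 _·_
_·_ : ∀ {n} → (Fin n → ℤ) → (Fin n → ℤ) → ℤ
r · x = Σℤ.sum λ j → r j * x j

·-zeroˡ : ∀ {n} (r x : Fin n → ℤ) → (∀ j → r j ≡ 0ℤ) → r · x ≡ 0ℤ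
·-zeroˡ {zero}  r x r≡0 = refl
·-zeroˡ {suc n} r x r≡0 = cong₂ (λ a b → a * x zero + b) (r≡0 zero) (·-zeroˡ (r ∘ suc) (x ∘ suc) (r≡0 ∘ suc))

·-scaleʳ : ∀ {n} p (r x : Fin n → ℤ) → r · (λ j → p * x j) ≡ p * (r · x)
·-scaleʳ {zero}  p r x = sym (ℤ.*-zeroʳ p)
·-scaleʳ {suc n} p r x =
  trans (cong (λ s → r zero * (p * x zero) + s) (·-scaleʳ p (r ∘ suc) (x ∘ suc)))
        (rearrange p (r zero) (x zero) ((r ∘ suc) · (x ∘ suc)))
  where
  rearrange : ∀ p a b s → a * (p * b) + p * s ≡ p * (a * b + s)
  rearrange = solve-∀

·-combineˡ : ∀ {n} p q (r s x : Fin n → ℤ) →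
             (λ j → p * r j - q * s j) · x ≡ p * (r · x) - q * (s · x)
·-combineˡ {zero}  p q r s x = sym (cong₂ _-_ (ℤ.*-zeroʳ p) (ℤ.*-zeroʳ q))
·-combineˡ {suc n} p q r s x =
  trans (cong (λ t → (p * r zero - q * s zero) * x zero + t) (·-combineˡ p q (r ∘ suc) (s ∘ suc) (x ∘ suc)))
        (rearrange p q (r zero) (s zero) (x zero) ((r ∘ suc) · (x ∘ suc)) ((s ∘ suc) · (x ∘ suc)))
  where
  rearrange : ∀ p q a b x s t → (p * a - q * b) * x + (p * s - q * t) ≡ p * (a * x + s) - q * (b * x + t)
  rearrange = solve-∀

·-insertAt : ∀ {n} (r : Fin (suc n) → ℤ) (x : Fin n → ℤ) j v →
             r · insertAt x j v ≡ r j * v + removeAt r j · x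
·-insertAt r x j v = trans (Σℤ.sum-remove {i = j} (λ l → r l * insertAt x j v l))
  (cong₂ _+_ (cong (r j *_) (insertAt-lookup x j v))
             (Σℤ.sum-cong-≗ λ l → cong (r (punchIn j l) *_) (insertAt-punchIn x j v l)))

-- Gaussian elimination without division: each pivot step scales the remaining rows.
kernel : ∀ m {n} (rs : List (Fin n → ℤ)) → length rs ℕ.≤ m → m ℕ.< n →
         ∃ λ x → (∃ λ j → x j ≢ 0ℤ) × All (λ r → r · x ≡ 0ℤ) rs
kernel m {suc n} [] _ _ = (λ _ → 1ℤ) , (zero , λ ()) , []
kernel (suc m) {suc n} (r ∷ rs) (s≤s ∣rs∣≤m) (s≤s m<n) with any? (λ j → ¬? (r j ≟ᶻ 0ℤ))
-- A zero row constrains nothing, so it is dropped and the number of unknowns stays the same.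
... | no r≡0 =
  let x , x≢0 , rs·x≡0 = kernel m rs ∣rs∣≤m (ℕ.m≤n⇒m≤1+n m<n)
  in x , x≢0 , ·-zeroˡ r x (λ j → decidable-stable (r j ≟ᶻ 0ℤ) λ rj≢0 → r≡0 (j , rj≢0)) ∷ rs·x≡0
... | yes (j , rj≢0)
  with kernel m (map (λ s l → r j * removeAt s j l - s j * removeAt r j l) rs)
              (subst (ℕ._≤ m) (sym (length-map _ rs)) ∣rs∣≤m) m<n
... | y , (l , yl≢0) , rs·y≡0 =
  x , (punchIn j l , x≢0) , trans (row r) (ring₀ (r j) S) ∷ All.map (λ {s} → back s) (map⁻ rs·y≡0)
  where
  S : ℤ
  S = removeAt r j · y
  x : Fin (suc n) → ℤ
  -- Row `r` would put `- S / r j` at the pivot coordinate; scaling all of `y` by `r j` makes this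
  -- entry the integer `- S`.
  x = insertAt (λ l → r j * y l) j (- S)
  x≢0 : x (punchIn j l) ≢ 0ℤ
  x≢0 eq with ℤ.i*j≡0⇒i≡0∨j≡0 (r j) (trans (sym (insertAt-punchIn _ j _ l)) eq)
  ... | inj₁ rj≡0 = rj≢0 rj≡0
  ... | inj₂ yl≡0 = yl≢0 yl≡0
  row : ∀ s → s · x ≡ s j * - S + r j * (removeAt s j · y)
  row s = trans (·-insertAt s _ j _) (cong (λ t → s j * - S + t) (·-scaleʳ (r j) (removeAt s j) y))
  ring₀ : ∀ p t → p * - t + p * t ≡ 0ℤ
  ring₀ = solve-∀
  ring₁ : ∀ p q s t → q * - t + p * s ≡ p * s - q * t
  ring₁ = solve-∀
  back : ∀ s → (λ l → r j * removeAt s j l - s j * removeAt r j l) · y ≡ 0ℤ → s · x ≡ 0ℤ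
  back s eq = trans (row s) (trans (ring₁ (r j) (s j) (removeAt s j · y) S)
    (trans (sym (·-combineˡ (r j) (s j) (removeAt s j) (removeAt r j) y)) eq))

-- Finite sums and indicator functions.

module _ {a ℓ} (M : CommutativeMonoid a ℓ) where
  open CommutativeMonoid M using (Carrier; _≈_; _∙_; ε; ∙-congˡ; identityʳ) renaming (trans to ≈-trans)

  sum-single : (t : Fin n → Carrier) (i : Fin n) → (∀ j → j ≢ i → t j ≈ ε) → Sum.sum M t ≈ t i
  sum-single {suc n} t i t≈0 = ≈-trans (Sum.sum-remove M {i = i} t)
    (≈-trans (∙-congˡ (≈-trans (Sum.sum-cong-≋ M (λ j → t≈0 _ (punchInᵢ≢i i j))) (Sum.sum-replicate-zero M n)))
             (identityʳ _))

ind : ∀ {p} {P : Set p} → Dec P → ℕ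
ind P? = if does P? then 1 else 0

ind-true : ∀ {p} {P : Set p} (P? : Dec P) → P → ind P? ≡ 1
ind-true P? p = cong (if_then 1 else 0) (dec-true P? p)

ind-false : ∀ {p} {P : Set p} (P? : Dec P) → ¬ P → ind P? ≡ 0
ind-false P? ¬p = cong (if_then 1 else 0) (dec-false P? ¬p)

ind-cong : ∀ {p q} {P : Set p} {Q : Set q} (P? : Dec P) (Q? : Dec Q) → (P → Q) → (Q → P) → ind P? ≡ ind Q?
ind-cong P? (yes q) to from = ind-true P? (from q)
ind-cong P? (no ¬q) to from = ind-false P? (¬q ∘ to)

ind-mono : ∀ {p q} {P : Set p} {Q : Set q} (P? : Dec P) (Q? : Dec Q) → (P → Q) → ind P? ℕ.≤ ind Q?
ind-mono (yes p) Q? to = ℕ.≤-reflexive (sym (ind-true Q? (to p)))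
ind-mono (no _)  Q? to = z≤n

length-filter-tabulate : ∀ {a p} {A : Set a} {P : Pred A p} (P? : Decidable P) (f : Fin n → A) →
                         length (filter P? (tabulate f)) ≡ sum (λ i → ind (P? (f i)))
length-filter-tabulate {zero}  P? f = refl
length-filter-tabulate {suc n} P? f with does (P? (f zero))
... | true = cong suc (length-filter-tabulate P? (f ∘ suc))
... | false = length-filter-tabulate P? (f ∘ suc)

sum-ind-complement : ∀ {p} {P : Pred (Fin n) p} (P? : Decidable P) →
                     sum (ind ∘ P?) ℕ.+ sum (ind ∘ ¬? ∘ P?) ≡ n
sum-ind-complement {zero}  P? = refl
sum-ind-complement {suc n} P? with does (P? zero)
... | true  = cong suc (sum-ind-complement (P? ∘ suc))
... | false = trans (ℕ.+-suc _ _) (cong suc (sum-ind-complement (P? ∘ suc)))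

sum-mono-≤ : {f g : Fin n → ℕ} → (∀ i → f i ℕ.≤ g i) → sum f ℕ.≤ sum g
sum-mono-≤ {zero}  f≤g = z≤n
sum-mono-≤ {suc n} f≤g = ℕ.+-mono-≤ (f≤g zero) (sum-mono-≤ (f≤g ∘ suc))

sum-mono-< : {f g : Fin n → ℕ} → (∀ i → f i ℕ.≤ g i) → ∀ j → f j ℕ.< g j → sum f ℕ.< sum g
sum-mono-< f≤g zero    fj<gj = ℕ.+-mono-<-≤ fj<gj (sum-mono-≤ (f≤g ∘ suc))
sum-mono-< f≤g (suc j) fj<gj = ℕ.+-mono-≤-< (f≤g zero) (sum-mono-< (f≤g ∘ suc) j fj<gj)

-- Coordinate vectors.

δ : Fin n → Fin n → ℤ
δ i j = ℤ.+ ind (j ≟ i)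

δ-· : (i : Fin n) (x : Fin n → ℤ) → δ i · x ≡ x i
δ-· i x = trans
  (sum-single ℤ.+-0-commutativeMonoid (λ j → δ i j * x j) i
    (λ j j≢i → cong (λ e → ℤ.+ e * x j) (ind-false (j ≟ i) j≢i)))
  (trans (cong (λ e → ℤ.+ e * x i) (ind-true (i ≟ i) refl)) (ℤ.*-identityˡ (x i)))

·-distribˡ-+ : (r s x : Fin n → ℤ) → (λ j → r j + s j) · x ≡ r · x + s · x
·-distribˡ-+ r s x = trans (Σℤ.sum-cong-≗ (λ j → ℤ.*-distribʳ-+ (x j) (r j) (s j)))
                           (Σℤ.∑-distrib-+ (λ j → r j * x j) (λ j → s j * x j))

-- Partial colourings.

-- c z = 0 means that z is not yet coloured; otherwise the colour is the sign of c z.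
Colouring : ℕ → Set
Colouring n = Fin n → ℤ

Extends : Colouring n → Colouring n → Set
Extends c c′ = ∀ z → c z ≢ 0ℤ → c′ z ≡ c z

extends-≢0 : {c c′ : Colouring n} → Extends c c′ → ∀ z → c z ≢ 0ℤ → c′ z ≢ 0ℤ
extends-≢0 ext z cz≢0 c′z≡0 = cz≢0 (trans (sym (ext z cz≢0)) c′z≡0)

extends-≡0 : {c c′ : Colouring n} → Extends c c′ → ∀ z → c′ z ≡ 0ℤ → c z ≡ 0ℤ
extends-≡0 {c = c} ext z c′z≡0 = decidable-stable (c z ≟ᶻ 0ℤ) λ cz≢0 → extends-≢0 ext z cz≢0 c′z≡0

blank : Colouring n → Fin n → ℕ
blank c z = ind (c z ≟ᶻ 0ℤ)

-- This count is both the number of free unknowns in the linear systems and the measure that drops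
-- in every recursion on colourings.
blanks : Colouring n → ℕ
blanks c = sum (blank c)

blanks-decrease : {c c′ : Colouring n} → Extends c c′ → ∀ j → c j ≡ 0ℤ → c′ j ≢ 0ℤ → blanks c′ ℕ.< blanks c
blanks-decrease {c = c} {c′} ext j cj≡0 c′j≢0 = sum-mono-< mono j
  (subst₂ ℕ._<_ (sym (ind-false (c′ j ≟ᶻ 0ℤ) c′j≢0)) (sym (ind-true (c j ≟ᶻ 0ℤ) cj≡0)) (s≤s z≤n))
  where
  mono : ∀ i → blank c′ i ℕ.≤ blank c i
  mono i with c′ i ≟ᶻ 0ℤ
  ... | no _ = z≤n
  ... | yes c′i≡0 = ℕ.≤-reflexive (sym (ind-true (c i ≟ᶻ 0ℤ) (extends-≡0 ext i c′i≡0)))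

-- Neighbourhoods in a cubic graph and double counting.

module CubicGraph {n} (G : Graph n) (cubic : Cubic G) where

  _~_ : Fin n → Fin n → Set
  _~_ = Adj G

  ~-sym : ∀ {u v} → u ~ v → v ~ u
  ~-sym = Graph.sym G

  ~⇒≢ : ∀ {u v} → u ~ v → u ≢ v
  ~⇒≢ u~v refl = irrefl G u~v

  n₁ n₂ n₃ : Fin n → Fin n
  n₁ u = proj₁ (cubic u)
  n₂ u = proj₁ (proj₂ (cubic u))
  n₃ u = proj₁ (proj₂ (proj₂ (cubic u)))

  ~n₁ : ∀ u → u ~ n₁ u
  ~n₁ u = let _ , _ , _ , a , _ = cubic u in a

  ~n₂ : ∀ u → u ~ n₂ u
  ~n₂ u = let _ , _ , _ , _ , a , _ = cubic u in a

  ~n₃ : ∀ u → u ~ n₃ u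
  ~n₃ u = let _ , _ , _ , _ , _ , a , _ = cubic u in a

  n₁≢n₂ : ∀ u → n₁ u ≢ n₂ u
  n₁≢n₂ u = let _ , _ , _ , _ , _ , _ , ne , _ = cubic u in ne

  n₁≢n₃ : ∀ u → n₁ u ≢ n₃ u
  n₁≢n₃ u = let _ , _ , _ , _ , _ , _ , _ , ne , _ = cubic u in ne

  n₂≢n₃ : ∀ u → n₂ u ≢ n₃ u
  n₂≢n₃ u = let _ , _ , _ , _ , _ , _ , _ , _ , ne , _ = cubic u in ne

  neighbours : ∀ {u v} → u ~ v → v ≡ n₁ u ⊎ v ≡ n₂ u ⊎ v ≡ n₃ u
  neighbours {u} {v} = let _ , _ , _ , _ , _ , _ , _ , _ , _ , all = cubic u in all v

  -- Adjacency is an arbitrary relation; the complete list of three neighbours is what makes it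
  -- decidable.
  _~?_ : ∀ u v → Dec (u ~ v)
  u ~? v = map′ to neighbours (v ≟ n₁ u ⊎-dec v ≟ n₂ u ⊎-dec v ≟ n₃ u)
    where
    to : v ≡ n₁ u ⊎ v ≡ n₂ u ⊎ v ≡ n₃ u → u ~ v
    to (inj₁ refl) = ~n₁ u
    to (inj₂ (inj₁ refl)) = ~n₂ u
    to (inj₂ (inj₂ refl)) = ~n₃ u

  two-others : ∀ {u v} → u ~ v → ∃ λ p → ∃ λ q →
    u ~ p × u ~ q × p ≢ q × p ≢ v × q ≢ v × (∀ w → u ~ w → w ≡ v ⊎ w ≡ p ⊎ w ≡ q)
  two-others {u} u~v with neighbours u~v
  ... | inj₁ refl = n₂ u , n₃ u , ~n₂ u , ~n₃ u , n₂≢n₃ u , n₁≢n₂ u ∘ sym , n₁≢n₃ u ∘ sym , λ w → neighbours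
  ... | inj₂ (inj₁ refl) = n₁ u , n₃ u , ~n₁ u , ~n₃ u , n₁≢n₃ u , n₁≢n₂ u , n₂≢n₃ u ∘ sym ,
        λ w u~w → [ inj₂ ∘ inj₁ , [ inj₁ , inj₂ ∘ inj₂ ]′ ]′ (neighbours u~w)
  ... | inj₂ (inj₂ refl) = n₁ u , n₂ u , ~n₁ u , ~n₂ u , n₁≢n₂ u , n₁≢n₃ u , n₂≢n₃ u ,
        λ w u~w → [ inj₂ ∘ inj₁ , [ inj₂ ∘ inj₂ , inj₁ ]′ ]′ (neighbours u~w)

  third : ∀ {u v w} → u ~ v → u ~ w → v ≢ w → ∃ λ p →
    u ~ p × p ≢ v × p ≢ w × (∀ z → u ~ z → z ≡ v ⊎ z ≡ w ⊎ z ≡ p)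
  third {w = w} u~v u~w v≢w with two-others u~v
  ... | p , q , u~p , u~q , p≢q , p≢v , q≢v , all with all w u~w
  ... | inj₁ refl = contradiction refl v≢w
  ... | inj₂ (inj₁ refl) = q , u~q , q≢v , p≢q ∘ sym , all
  ... | inj₂ (inj₂ refl) = p , u~p , p≢v , p≢q ,
        λ z u~z → [ inj₁ , [ inj₂ ∘ inj₂ , inj₂ ∘ inj₁ ]′ ]′ (all z u~z)

  Σ₃ : (Fin n → ℕ) → Fin n → ℕ
  Σ₃ f u = f (n₁ u) ℕ.+ (f (n₂ u) ℕ.+ f (n₃ u))

  -- A neighbourhood sum becomes a row of the adjacency matrix, so that `double-count` can exchange
  -- the two summations.
  Σ₃-adjacency : ∀ f u → sum (λ z → ind (u ~? z) ℕ.* f z) ≡ Σ₃ f u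
  Σ₃-adjacency f u =
    trans (Σℕ.sum-cong-≗ split)
    (trans (Σℕ.∑-distrib-+ (at n₁) (λ z → at n₂ z ℕ.+ at n₃ z))
    (cong₂ ℕ._+_ (sum-at n₁) (trans (Σℕ.∑-distrib-+ (at n₂) (at n₃)) (cong₂ ℕ._+_ (sum-at n₂) (sum-at n₃)))))
    where
    at : (Fin n → Fin n) → Fin n → ℕ
    at m z = ind (z ≟ m u) ℕ.* f z
    sum-at : ∀ m → sum (at m) ≡ f (m u)
    sum-at m = trans
      (sum-single ℕ.+-0-commutativeMonoid (at m) (m u)
        (λ z z≢ → cong (ℕ._* f z) (ind-false (z ≟ m u) z≢)))
      (trans (cong (ℕ._* f (m u)) (ind-true (m u ≟ m u) refl)) (ℕ.*-identityˡ (f (m u))))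
    split : ∀ z → ind (u ~? z) ℕ.* f z ≡ at n₁ z ℕ.+ (at n₂ z ℕ.+ at n₃ z)
    split z with z ≟ n₁ u | z ≟ n₂ u | z ≟ n₃ u
    ... | yes refl | yes eq | _ = contradiction eq (n₁≢n₂ u)
    ... | yes refl | no _ | yes eq = contradiction eq (n₁≢n₃ u)
    ... | yes refl | no _ | no _ = sym (ℕ.+-identityʳ _)
    ... | no _ | yes refl | yes eq = contradiction eq (n₂≢n₃ u)
    ... | no _ | yes refl | no _ = sym (ℕ.+-identityʳ _)
    ... | no _ | no _ | yes refl = refl
    ... | no _ | no _ | no _ = refl

  -- Each vertex lies in exactly three open neighbourhoods, because the adjacency matrix is
  -- symmetric with row sums 3.
  double-count : ∀ f → sum (Σ₃ f) ≡ 3 ℕ.* sum f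
  double-count f = begin
    sum (Σ₃ f)                                      ≡⟨ Σℕ.sum-cong-≗ (Σ₃-adjacency f) ⟨
    sum (λ u → sum (λ z → ind (u ~? z) ℕ.* f z))    ≡⟨ Σℕ.∑-comm (λ u z → ind (u ~? z) ℕ.* f z) ⟩
    sum (λ z → sum (λ u → ind (u ~? z) ℕ.* f z))    ≡⟨ Σℕ.sum-cong-≗ (λ z → trans
                                                         (Σℕ.sum-cong-≗ (λ u → cong (ℕ._* f z) (ind-cong (u ~? z) (z ~? u) ~-sym ~-sym)))
                                                         (trans (Σ₃-adjacency (λ _ → f z) z) (thrice (f z)))) ⟩
    sum (λ z → 3 ℕ.* f z)                           ≡⟨ Σℕ.*-distribˡ-sum 3 f ⟨
    3 ℕ.* sum f                                     ∎
    where
    open ≡-Reasoning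
    thrice : ∀ a → a ℕ.+ (a ℕ.+ a) ≡ 3 ℕ.* a
    thrice = solve-∀ᴺ

  ≤Σ₃ : ∀ f {u v} → u ~ v → f v ℕ.≤ Σ₃ f u
  ≤Σ₃ f {u} u~v with neighbours u~v
  ... | inj₁ refl = ℕ.m≤m+n _ _
  ... | inj₂ (inj₁ refl) = ℕ.≤-trans (ℕ.m≤m+n _ _) (ℕ.m≤n+m _ (f (n₁ u)))
  ... | inj₂ (inj₂ refl) = ℕ.≤-trans (ℕ.m≤n+m _ (f (n₂ u))) (ℕ.m≤n+m _ (f (n₁ u)))

  +≤Σ₃ : ∀ f {u v w} → u ~ v → u ~ w → v ≢ w → f v ℕ.+ f w ℕ.≤ Σ₃ f u
  +≤Σ₃ f {u} u~v u~w v≢w with neighbours u~v | neighbours u~w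
  ... | inj₁ refl | inj₁ refl = contradiction refl v≢w
  ... | inj₁ refl | inj₂ (inj₁ refl) = ℕ.+-monoʳ-≤ (f (n₁ u)) (ℕ.m≤m+n _ _)
  ... | inj₁ refl | inj₂ (inj₂ refl) = ℕ.+-monoʳ-≤ (f (n₁ u)) (ℕ.m≤n+m _ _)
  ... | inj₂ (inj₁ refl) | inj₁ refl = subst (ℕ._≤ Σ₃ f u) (ℕ.+-comm (f (n₁ u)) _) (ℕ.+-monoʳ-≤ (f (n₁ u)) (ℕ.m≤m+n _ _))
  ... | inj₂ (inj₁ refl) | inj₂ (inj₁ refl) = contradiction refl v≢w
  ... | inj₂ (inj₁ refl) | inj₂ (inj₂ refl) = ℕ.m≤n+m _ (f (n₁ u))
  ... | inj₂ (inj₂ refl) | inj₁ refl = subst (ℕ._≤ Σ₃ f u) (ℕ.+-comm (f (n₁ u)) _) (ℕ.+-monoʳ-≤ (f (n₁ u)) (ℕ.m≤n+m _ _))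
  ... | inj₂ (inj₂ refl) | inj₂ (inj₁ refl) = subst (ℕ._≤ Σ₃ f u) (ℕ.+-comm (f (n₂ u)) _) (ℕ.m≤n+m _ (f (n₁ u)))
  ... | inj₂ (inj₂ refl) | inj₂ (inj₂ refl) = contradiction refl v≢w

  -- Bichromatic and blank clauses.

  Sat : Colouring n → Fin n → Set
  Sat c u = (∃ λ p → u ~ p × 0ℤ < c p) × (∃ λ q → u ~ q × c q < 0ℤ)

  sat-extend : ∀ {c c′ u} → Extends c c′ → Sat c u → Sat c′ u
  sat-extend {c} {c′} ext ((p , u~p , 0<p) , (q , u~q , q<0)) =
    (p , u~p , subst (0ℤ <_) (sym (ext p (ℤ.<⇒≢ 0<p ∘ sym))) 0<p) ,
    (q , u~q , subst (_< 0ℤ) (sym (ext q (ℤ.<⇒≢ q<0))) q<0)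

  sat-opposite : ∀ {c : Colouring n} {u p q} → u ~ p → u ~ q → c p ≢ 0ℤ → c q ≡ - c p → Sat c u
  sat-opposite {c} {p = p} {q} u~p u~q cp≢0 cq≡-cp with ℤ.<-cmp 0ℤ (c p)
  ... | tri< 0<p _ _ = (p , u~p , 0<p) , (q , u~q , subst (_< 0ℤ) (sym cq≡-cp) (ℤ.neg-mono-< 0<p))
  ... | tri≈ _ 0≡p _ = contradiction (sym 0≡p) cp≢0
  ... | tri> _ _ p<0 = (q , u~q , subst (0ℤ <_) (sym cq≡-cp) (ℤ.neg-mono-< p<0)) , (p , u~p , p<0)

  -- This concerns the neighbours of `u` only; `u` itself may be coloured.
  Blank : Colouring n → Fin n → Set
  Blank c u = c (n₁ u) ≡ 0ℤ × c (n₂ u) ≡ 0ℤ × c (n₃ u) ≡ 0ℤ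

  blank? : ∀ c u → Dec (Blank c u)
  blank? c u = c (n₁ u) ≟ᶻ 0ℤ ×-dec c (n₂ u) ≟ᶻ 0ℤ ×-dec c (n₃ u) ≟ᶻ 0ℤ

  blank-lookup : ∀ {c u v} → Blank c u → u ~ v → c v ≡ 0ℤ
  blank-lookup (z₁ , z₂ , z₃) u~v with neighbours u~v
  ... | inj₁ refl = z₁
  ... | inj₂ (inj₁ refl) = z₂
  ... | inj₂ (inj₂ refl) = z₃

  -- If the first entry is nonzero, one of the others must have the opposite sign, or else the sum
  -- would be strictly positive or strictly negative. If it is zero, the other two are opposite.
  zero-sum⇒blank⊎sat : ∀ (x : Colouring n) u → x (n₁ u) + x (n₂ u) + x (n₃ u) ≡ 0ℤ → Blank x u ⊎ Sat x u
  zero-sum⇒blank⊎sat x u Σ≡0 with ℤ.<-cmp 0ℤ (x (n₁ u))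
  zero-sum⇒blank⊎sat x u Σ≡0 | tri≈ _ 0≡a _ with x (n₂ u) ≟ᶻ 0ℤ
  ... | no b≢0 = inj₂ (sat-opposite (~n₂ u) (~n₃ u) b≢0 c≡-b)
    where
    c≡-b : x (n₃ u) ≡ - x (n₂ u)
    c≡-b = inverseʳ-unique _ _
      (trans (cong (_+ x (n₃ u)) (trans (sym (ℤ.+-identityˡ (x (n₂ u)))) (cong (_+ x (n₂ u)) 0≡a))) Σ≡0)
  ... | yes b≡0 = inj₁ (sym 0≡a , b≡0 ,
    trans (sym (trans (cong₂ (λ a b → a + b + x (n₃ u)) (sym 0≡a) b≡0) (ℤ.+-identityˡ _))) Σ≡0)
  zero-sum⇒blank⊎sat x u Σ≡0 | tri< 0<a _ _ with x (n₂ u) <? 0ℤ | x (n₃ u) <? 0ℤ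
  ... | yes b<0 | _ = inj₂ ((n₁ u , ~n₁ u , 0<a) , (n₂ u , ~n₂ u , b<0))
  ... | no _ | yes c<0 = inj₂ ((n₁ u , ~n₁ u , 0<a) , (n₃ u , ~n₃ u , c<0))
  ... | no b≮0 | no c≮0 = contradiction (sym Σ≡0)
    (ℤ.<⇒≢ (ℤ.+-mono-<-≤ (ℤ.+-mono-<-≤ 0<a (ℤ.≮⇒≥ b≮0)) (ℤ.≮⇒≥ c≮0)))
  zero-sum⇒blank⊎sat x u Σ≡0 | tri> _ _ a<0 with 0ℤ <? x (n₂ u) | 0ℤ <? x (n₃ u)
  ... | yes 0<b | _ = inj₂ ((n₂ u , ~n₂ u , 0<b) , (n₁ u , ~n₁ u , a<0))
  ... | no _ | yes 0<c = inj₂ ((n₃ u , ~n₃ u , 0<c) , (n₁ u , ~n₁ u , a<0))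
  ... | no 0≮b | no 0≮c = contradiction Σ≡0
    (ℤ.<⇒≢ (ℤ.+-mono-<-≤ (ℤ.+-mono-<-≤ a<0 (ℤ.≮⇒≥ 0≮b)) (ℤ.≮⇒≥ 0≮c)))

  -- The linear system of the sign trick.

  clause : Fin n → Fin n → ℤ
  clause u z = δ (n₁ u) z + δ (n₂ u) z + δ (n₃ u) z

  clause-· : ∀ u x → clause u · x ≡ x (n₁ u) + x (n₂ u) + x (n₃ u)
  clause-· u x =
    trans (·-distribˡ-+ (λ z → δ (n₁ u) z + δ (n₂ u) z) (δ (n₃ u)) x)
          (cong₂ _+_ (trans (·-distribˡ-+ (δ (n₁ u)) (δ (n₂ u)) x) (cong₂ _+_ (δ-· (n₁ u) x) (δ-· (n₂ u) x)))
                     (δ-· (n₃ u) x))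

  -- The unit vectors of the coloured vertices join the rows and confine the solution to uncoloured
  -- vertices. Coloured and uncoloured vertices together number `n`, so the hypothesis says that
  -- there are fewer rows than unknowns.
  solve-clauses : ∀ (c : Colouring n) {p} {P : Pred (Fin n) p} (P? : Decidable P) (es : List (Fin n → ℤ)) →
    sum (ind ∘ P?) ℕ.+ length es ℕ.< blanks c →
    ∃ λ (k : Colouring n) → (∃ λ j → k j ≢ 0ℤ) × (∀ z → c z ≢ 0ℤ → k z ≡ 0ℤ) ×
      (∀ u → P u → Blank k u ⊎ Sat k u) × All (λ e → e · k ≡ 0ℤ) es
  solve-clauses c {P = P} P? es few =
    let k , k≢0 , rows·k≡0 = kernel (length rows) rows ℕ.≤-refl small
        clauses·k≡0 , rest = ++⁻ (map clause Ps) rows·k≡0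
        fixed·k≡0 , es·k≡0 = ++⁻ (map δ Cs) rest
    in k , k≢0 ,
       (λ z cz≢0 → trans (sym (δ-· z k)) (All.lookup (map⁻ fixed·k≡0) (∈-filter⁺ coloured? (∈-allFin z) cz≢0))) ,
       (λ u pu → zero-sum⇒blank⊎sat k u
         (trans (sym (clause-· u k)) (All.lookup (map⁻ clauses·k≡0) (∈-filter⁺ P? (∈-allFin u) pu)))) ,
       es·k≡0
    where
    coloured? : Decidable (λ z → c z ≢ 0ℤ)
    coloured? z = ¬? (c z ≟ᶻ 0ℤ)
    Ps Cs : List (Fin n)
    Ps = filter P? (allFin n)
    Cs = filter coloured? (allFin n)
    rows : List (Fin n → ℤ)
    rows = map clause Ps ++ (map δ Cs ++ es)
    p q : ℕ
    p = sum (ind ∘ P?)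
    q = sum (ind ∘ coloured?)
    ∣rows∣ : length rows ≡ p ℕ.+ length es ℕ.+ q
    ∣rows∣ = begin
      length rows                                       ≡⟨ length-++ (map clause Ps) ⟩
      length (map clause Ps) ℕ.+ length (map δ Cs ++ es) ≡⟨ cong₂ ℕ._+_ (trans (length-map clause Ps) (length-filter-tabulate P? id)) (length-++ (map δ Cs)) ⟩
      p ℕ.+ (length (map δ Cs) ℕ.+ length es)           ≡⟨ cong (λ m → p ℕ.+ (m ℕ.+ length es)) (trans (length-map δ Cs) (length-filter-tabulate coloured? id)) ⟩
      p ℕ.+ (q ℕ.+ length es)                           ≡⟨ rearrange p q (length es) ⟩
      p ℕ.+ length es ℕ.+ q                             ∎
      where
      open ≡-Reasoning
      rearrange : ∀ a b c → a ℕ.+ (b ℕ.+ c) ≡ a ℕ.+ c ℕ.+ b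
      rearrange = solve-∀ᴺ
    small : length rows ℕ.< n
    small = subst₂ ℕ._<_ (sym ∣rows∣) (sum-ind-complement (λ z → c z ≟ᶻ 0ℤ)) (ℕ.+-monoˡ-< q few)


  -- The invariant: a clause that has begun to be coloured shows both colours.
  Good : Colouring n → Set
  Good c = ∀ u → Blank c u ⊎ Sat c u

  Improvement : Colouring n → Set
  Improvement c = ∃ λ c′ → Good c′ × blanks c′ ℕ.< blanks c

  -- With disjoint supports, the pointwise sum is the union of two partial colourings.
  module Merge (c k : Colouring n) (disjoint : ∀ z → c z ≢ 0ℤ → k z ≡ 0ℤ) where

    merged : Colouring n
    merged z = c z + k z

    extendsˡ : Extends c merged
    extendsˡ z cz≢0 = trans (cong (c z +_) (disjoint z cz≢0)) (ℤ.+-identityʳ (c z))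

    support : ∀ z → k z ≢ 0ℤ → c z ≡ 0ℤ
    support z kz≢0 = decidable-stable (c z ≟ᶻ 0ℤ) (kz≢0 ∘ disjoint z)

    extendsʳ : Extends k merged
    extendsʳ z kz≢0 = trans (cong (_+ k z) (support z kz≢0)) (ℤ.+-identityˡ (k z))

    -- Bichromatic clauses survive any extension, so only the clauses still blank in `c` need an
    -- equation.
    progress : ∀ {u} → (Blank c u → Blank k u ⊎ Sat k u) → Blank c u ⊎ Sat c u → Blank merged u ⊎ Sat merged u
    progress sol (inj₂ sat) = inj₂ (sat-extend extendsˡ sat)
    progress sol (inj₁ blank@(a , b , c)) with sol blank
    ... | inj₁ (a′ , b′ , c′) = inj₁ (cong₂ _+_ a a′ , cong₂ _+_ b b′ , cong₂ _+_ c c′)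
    ... | inj₂ sat = inj₂ (sat-extend extendsʳ sat)

    fewer-blanks : ∀ j → k j ≢ 0ℤ → blanks merged ℕ.< blanks c
    fewer-blanks j kj≢0 = blanks-decrease extendsˡ j (support j kj≢0) (extends-≢0 extendsʳ j kj≢0)

  blank-clauses : ∀ c u → 3 ℕ.* ind (blank? c u) ℕ.≤ Σ₃ (blank c) u
  blank-clauses c u with c (n₁ u) ≟ᶻ 0ℤ | c (n₂ u) ≟ᶻ 0ℤ | c (n₃ u) ≟ᶻ 0ℤ
  ... | yes _ | yes _ | yes _ = ℕ.≤-refl
  ... | yes _ | yes _ | no _  = z≤n
  ... | yes _ | no _  | _     = z≤n
  ... | no _  | _     | _     = z≤n

  -- Summing `blank-clauses` over all vertices bounds the blank clauses by the uncoloured vertices.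
  -- A mixed clause adds to the right side only, which makes the bound strict and yields a nonzero
  -- solution.
  improve-mixed : ∀ {c u z} → Good c → ¬ Blank c u → u ~ z → c z ≡ 0ℤ → Improvement c
  improve-mixed {c} {u} {z} good ¬blank u~z cz≡0 =
    let k , (j , kj≢0) , disjoint , sol , _ = solve-clauses c (blank? c) [] few
        open Merge c k disjoint
    in merged , (λ t → progress (sol t) (good t)) , fewer-blanks j kj≢0
    where
    strict : 3 ℕ.* ind (blank? c u) ℕ.< Σ₃ (blank c) u
    strict = ℕ.≤-trans
      (ℕ.≤-reflexive (trans (cong (λ e → suc (3 ℕ.* e)) (ind-false (blank? c u) ¬blank))
                            (sym (ind-true (c z ≟ᶻ 0ℤ) cz≡0))))
      (≤Σ₃ (blank c) u~z)
    few : sum (ind ∘ blank? c) ℕ.+ 0 ℕ.< blanks c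
    few = subst (ℕ._< blanks c) (sym (ℕ.+-identityʳ _)) (ℕ.*-cancelˡ-< 3 _ _
      (subst₂ ℕ._<_ (sym (Σℕ.*-distribˡ-sum 3 (ind ∘ blank? c))) (double-count (blank c))
        (sum-mono-< (blank-clauses c) u strict)))

  -- Four-cycles.

  -- Here `w` is opposite `v` on the cycle `v u₁ w u₂`. Adjacent vertices differ by irreflexivity,
  -- so with the two inequalities all four are distinct.
  InC4 : Fin n → Set
  InC4 v = ∃ λ w → ∃ λ u₁ → ∃ λ u₂ → v ≢ w × u₁ ≢ u₂ × u₁ ~ v × u₁ ~ w × u₂ ~ v × u₂ ~ w

  inC4? : ∀ v → Dec (InC4 v)
  inC4? v = any? λ w → any? λ u₁ → any? λ u₂ →
    ¬? (v ≟ w) ×-dec ¬? (u₁ ≟ u₂) ×-dec u₁ ~? v ×-dec u₁ ~? w ×-dec u₂ ~? v ×-dec u₂ ~? w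

  -- The clauses of u₁ and u₂ are replaced by the single equation x v + x w = 0, which
  -- keeps the system underdetermined until v and w receive opposite colours.
  module Square {v w u₁ u₂ : Fin n} (v≢w : v ≢ w) (u₁≢u₂ : u₁ ≢ u₂)
                (u₁~v : u₁ ~ v) (u₁~w : u₁ ~ w) (u₂~v : u₂ ~ v) (u₂~w : u₂ ~ w) where

    Other : Fin n → Set
    Other t = t ≢ u₁ × t ≢ u₂

    -- While their equations are traded away, the clauses of `u₁` and `u₂` may be left with a single
    -- colour.
    GoodElsewhere : Colouring n → Set
    GoodElsewhere c = ∀ t → Other t → Blank c t ⊎ Sat c t

    Remaining : Colouring n → Fin n → Set
    Remaining c t = Other t × Blank c t

    remaining? : ∀ c → Decidable (Remaining c)
    remaining? c t = (¬? (t ≟ u₁) ×-dec ¬? (t ≟ u₂)) ×-dec blank? c t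

    -- In the double count each remaining clause weighs 3, while the clauses of `u₁` and `u₂` weigh
    -- at least 2 each, since both contain `v` and `w`.
    few-remaining : ∀ c → c v ≡ 0ℤ → c w ≡ 0ℤ → sum (ind ∘ remaining? c) ℕ.+ 1 ℕ.< blanks c
    few-remaining c cv≡0 cw≡0 =
      ℕ.*-cancelˡ-< 3 _ _ (subst₂ ℕ._≤_ sum-weight (double-count (blank c)) (sum-mono-≤ weight≤))
      where
      P? : Decidable (Remaining c)
      P? = remaining? c
      at₁ at₂ : Fin n → ℕ
      at₁ t = ind (t ≟ u₁)
      at₂ t = ind (t ≟ u₂)
      sum-at : ∀ i → sum (λ t → ind (t ≟ i)) ≡ 1
      sum-at i = trans (sum-single ℕ.+-0-commutativeMonoid (λ t → ind (t ≟ i)) i (λ t → ind-false (t ≟ i)))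
                       (ind-true (i ≟ i) refl)
      two : ∀ {u} → u ~ v → u ~ w → 2 ℕ.≤ Σ₃ (blank c) u
      two {u} u~v u~w = subst (ℕ._≤ Σ₃ (blank c) u)
        (cong₂ ℕ._+_ (ind-true (c v ≟ᶻ 0ℤ) cv≡0) (ind-true (c w ≟ᶻ 0ℤ) cw≡0))
        (+≤Σ₃ (blank c) u~v u~w v≢w)
      weight : Fin n → ℕ
      weight t = 3 ℕ.* ind (P? t) ℕ.+ (2 ℕ.* at₁ t ℕ.+ 2 ℕ.* at₂ t)
      weight≤ : ∀ t → weight t ℕ.≤ Σ₃ (blank c) t
      weight≤ t = by-cases (t ≟ u₁) (t ≟ u₂)
        where
        value : ∀ {a b d} → ind (P? t) ≡ a → at₁ t ≡ b → at₂ t ≡ d → weight t ≡ 3 ℕ.* a ℕ.+ (2 ℕ.* b ℕ.+ 2 ℕ.* d)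
        value refl refl refl = refl
        by-cases : Dec (t ≡ u₁) → Dec (t ≡ u₂) → weight t ℕ.≤ Σ₃ (blank c) t
        by-cases (yes refl) _ = ℕ.≤-trans
          (ℕ.≤-reflexive (value (ind-false (P? t) (λ ((t≢ , _) , _) → t≢ refl)) (ind-true (t ≟ u₁) refl) (ind-false (t ≟ u₂) u₁≢u₂)))
          (two u₁~v u₁~w)
        by-cases (no t≢u₁) (yes refl) = ℕ.≤-trans
          (ℕ.≤-reflexive (value (ind-false (P? t) (λ ((_ , t≢) , _) → t≢ refl)) (ind-false (t ≟ u₁) t≢u₁) (ind-true (t ≟ u₂) refl)))
          (two u₂~v u₂~w)
        by-cases (no t≢u₁) (no t≢u₂) = ℕ.≤-trans
          (ℕ.≤-reflexive (trans (value refl (ind-false (t ≟ u₁) t≢u₁) (ind-false (t ≟ u₂) t≢u₂)) (ℕ.+-identityʳ _)))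
          (ℕ.≤-trans (ℕ.*-monoʳ-≤ 3 (ind-mono (P? t) (blank? c t) proj₂)) (blank-clauses c t))
      -- Of the total weight 4 at `u₁` and `u₂`, 3 pays for the extra equation and 1 gives
      -- strictness.
      sum-weight : sum weight ≡ suc (3 ℕ.* (sum (ind ∘ P?) ℕ.+ 1))
      sum-weight = begin
        sum weight
          ≡⟨ Σℕ.∑-distrib-+ (λ t → 3 ℕ.* ind (P? t)) (λ t → 2 ℕ.* at₁ t ℕ.+ 2 ℕ.* at₂ t) ⟩
        sum (λ t → 3 ℕ.* ind (P? t)) ℕ.+ sum (λ t → 2 ℕ.* at₁ t ℕ.+ 2 ℕ.* at₂ t)
          ≡⟨ cong₂ ℕ._+_ (sym (Σℕ.*-distribˡ-sum 3 (ind ∘ P?)))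
                          (trans (Σℕ.∑-distrib-+ (λ t → 2 ℕ.* at₁ t) (λ t → 2 ℕ.* at₂ t))
                                 (cong₂ ℕ._+_ (sym (Σℕ.*-distribˡ-sum 2 at₁)) (sym (Σℕ.*-distribˡ-sum 2 at₂)))) ⟩
        3 ℕ.* sum (ind ∘ P?) ℕ.+ (2 ℕ.* sum at₁ ℕ.+ 2 ℕ.* sum at₂)
          ≡⟨ cong₂ (λ a b → 3 ℕ.* sum (ind ∘ P?) ℕ.+ (2 ℕ.* a ℕ.+ 2 ℕ.* b)) (sum-at u₁) (sum-at u₂) ⟩
        3 ℕ.* sum (ind ∘ P?) ℕ.+ 4
          ≡⟨ rearrange (sum (ind ∘ P?)) ⟩
        suc (3 ℕ.* (sum (ind ∘ P?) ℕ.+ 1)) ∎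
        where
        open ≡-Reasoning
        rearrange : ∀ a → 3 ℕ.* a ℕ.+ 4 ≡ suc (3 ℕ.* (a ℕ.+ 1))
        rearrange = solve-∀ᴺ

    improve : ∀ m c → blanks c ℕ.< m → GoodElsewhere c → c v ≡ 0ℤ → c w ≡ 0ℤ → Improvement c
    improve (suc m) c (s≤s blanks≤m) good cv≡0 cw≡0 =
      continue (solve-clauses c (remaining? c) ((λ z → δ v z + δ w z) ∷ []) (few-remaining c cv≡0 cw≡0))
      where
      continue : (∃ λ (k : Colouring n) → (∃ λ j → k j ≢ 0ℤ) × (∀ z → c z ≢ 0ℤ → k z ≡ 0ℤ) ×
        (∀ u → Remaining c u → Blank k u ⊎ Sat k u) × All (λ e → e · k ≡ 0ℤ) ((λ z → δ v z + δ w z) ∷ [])) → Improvement c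
      continue (k , (j , kj≢0) , disjoint , sol , (pair·k≡0 ∷ [])) = finish (k v ≟ᶻ 0ℤ)
        where
        open Merge c k disjoint
        kw≡-kv : k w ≡ - k v
        kw≡-kv = inverseʳ-unique (k v) (k w)
          (trans (sym (trans (·-distribˡ-+ (δ v) (δ w) k) (cong₂ _+_ (δ-· v k) (δ-· w k)))) pair·k≡0)
        good′ : GoodElsewhere merged
        good′ t other = progress (λ blank → sol t (other , blank)) (good t other)
        smaller : blanks merged ℕ.< blanks c
        smaller = fewer-blanks j kj≢0
        finish : Dec (k v ≡ 0ℤ) → Improvement c
        -- The opposite signs of `v` and `w` make both traded clauses bichromatic.
        finish (no kv≢0) = merged , all-good , smaller
          where
          opposite : ∀ {u} → u ~ v → u ~ w → Sat merged u
          opposite u~v u~w = sat-extend extendsʳ (sat-opposite u~v u~w kv≢0 kw≡-kv)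
          all-good : Good merged
          all-good t with t ≟ u₁ | t ≟ u₂
          ... | yes refl | _ = inj₂ (opposite u₁~v u₁~w)
          ... | no _ | yes refl = inj₂ (opposite u₂~v u₂~w)
          ... | no t≢u₁ | no t≢u₂ = good′ t (t≢u₁ , t≢u₂)
        -- As `v` and `w` are still uncoloured, the same trade applies to the larger colouring.
        finish (yes kv≡0) =
          let c′ , good″ , smaller′ = improve m merged (ℕ.<-≤-trans smaller blanks≤m) good′
                (cong₂ _+_ cv≡0 kv≡0) (cong₂ _+_ cw≡0 (trans kw≡-kv (cong -_ kv≡0)))
          in c′ , good″ , ℕ.<-trans smaller′ smaller

  -- The tight case of the double count: no clause is partly coloured.
  Closed : Colouring n → Set
  Closed c = ∀ {u z} → u ~ z → c z ≡ 0ℤ → Blank c u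

  colour-squares : ∀ m c → blanks c ℕ.< m → Good c →
    ∃ λ c′ → Good c′ × Closed c′ × (∀ z → c′ z ≡ 0ℤ → ¬ InC4 z)
  colour-squares (suc m) c (s≤s blanks≤m) good
    with any? (λ u → ¬? (blank? c u) ×-dec any? (λ z → u ~? z ×-dec c z ≟ᶻ 0ℤ))
  ... | yes (u , ¬blank , z , u~z , cz≡0) =
    let c′ , good′ , smaller = improve-mixed good ¬blank u~z cz≡0
    in colour-squares m c′ (ℕ.<-≤-trans smaller blanks≤m) good′
  ... | no ¬mixed with any? (λ v → c v ≟ᶻ 0ℤ ×-dec inC4? v)
  ... | no none = c , good ,
    (λ {u} {z} u~z cz≡0 → decidable-stable (blank? c u) λ ¬blank → ¬mixed (u , ¬blank , z , u~z , cz≡0)) ,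
    (λ z cz≡0 inC4 → none (z , cz≡0 , inC4))
  ... | yes (v , cv≡0 , w , u₁ , u₂ , v≢w , u₁≢u₂ , u₁~v , u₁~w , u₂~v , u₂~w) =
    -- No clause is mixed at this point, so `w` is uncoloured along with `v`.
    let blank = decidable-stable (blank? c u₁) λ ¬blank → ¬mixed (u₁ , ¬blank , v , u₁~v , cv≡0)
        c′ , good′ , smaller = Square.improve v≢w u₁≢u₂ u₁~v u₁~w u₂~v u₂~w (suc m) c (s≤s blanks≤m)
          (λ t _ → good t) cv≡0 (blank-lookup blank u₁~w)
    in colour-squares m c′ (ℕ.<-≤-trans smaller blanks≤m) good′

  -- Triangles.

  Triangle : Fin n → Fin n → Fin n → Set
  Triangle v p q = v ~ p × v ~ q × p ~ q

  InTriangle : Fin n → Set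
  InTriangle v = ∃ λ p → ∃ λ q → Triangle v p q

  inTriangle? : ∀ v → Dec (InTriangle v)
  inTriangle? v = any? λ p → any? λ q → v ~? p ×-dec v ~? q ×-dec p ~? q

  rotate : ∀ {v p q} → Triangle v p q → Triangle p q v
  rotate (v~p , v~q , p~q) = p~q , ~-sym v~p , ~-sym v~q

  -- As `v` has degree three, a second triangle at `v` would share an edge with the first, and the
  -- two would contain a 4-cycle through `v`.
  triangle-unique : ∀ {v p q r s} → ¬ InC4 v → Triangle v p q → Triangle v r s → r ≡ p ⊎ r ≡ q
  triangle-unique {v} {p} {q} {r} {s} ¬c4 (v~p , v~q , p~q) (v~r , v~s , r~s)
    with third v~p v~q (~⇒≢ p~q)
  ... | t , v~t , t≢p , t≢q , all with all r v~r | all s v~s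
  ... | inj₁ r≡p | _ = inj₁ r≡p
  ... | inj₂ (inj₁ r≡q) | _ = inj₂ r≡q
  ... | inj₂ (inj₂ refl) | inj₁ refl =
    contradiction (p , r , q , ~⇒≢ v~p , t≢q , ~-sym v~r , r~s , ~-sym v~q , ~-sym p~q) ¬c4
  ... | inj₂ (inj₂ refl) | inj₂ (inj₁ refl) =
    contradiction (q , r , p , ~⇒≢ v~q , t≢p , ~-sym v~r , r~s , ~-sym v~p , p~q) ¬c4
  ... | inj₂ (inj₂ refl) | inj₂ (inj₂ refl) = contradiction refl (~⇒≢ r~s)

  -- The uncoloured vertices are partitioned into triangles: by `triangle-unique`, avoiding 4-cycles
  -- leaves just one triangle at each of them.
  record Triangular (c : Colouring n) : Set where
    field
      in-triangle     : ∀ {v} → c v ≡ 0ℤ → InTriangle v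
      not-in-C4       : ∀ {v} → c v ≡ 0ℤ → ¬ InC4 v
      triangle-closed : ∀ {v p q} → c v ≡ 0ℤ → Triangle v p q → c p ≡ 0ℤ

  -- Once `y` has `d` and `p`, `q` have `- d`, both `p` and `q` see `y` and each other, hence two
  -- colours. Only `y` may still lack a neighbour coloured like itself, so `painted-sat` exempts it.
  module Paint {c : Colouring n} (triangular : Triangular c) {y p q : Fin n} (ypq : Triangle y p q)
               (cy≡0 : c y ≡ 0ℤ) (d : ℤ) (d≢0 : d ≢ 0ℤ) where
    open Triangular triangular

    private
      y~p : y ~ p
      y~p = proj₁ ypq
      y~q : y ~ q
      y~q = proj₁ (proj₂ ypq)
      cp≡0 : c p ≡ 0ℤ
      cp≡0 = triangle-closed cy≡0 ypq
      cq≡0 : c q ≡ 0ℤ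
      cq≡0 = triangle-closed cp≡0 (rotate ypq)
      -d≢0 : - d ≢ 0ℤ
      -d≢0 -d≡0 = d≢0 (ℤ.neg-injective -d≡0)

    private
      paint-pq : Colouring n
      paint-pq z = if does (z ≟ p ⊎-dec z ≟ q) then - d else c z

    painted : Colouring n
    painted z = if does (z ≟ y) then d else paint-pq z

    painted-y : painted y ≡ d
    painted-y = cong (if_then d else paint-pq y) (dec-true (y ≟ y) refl)

    private
      painted-pq : ∀ z → z ≢ y → z ≡ p ⊎ z ≡ q → painted z ≡ - d
      painted-pq z z≢y z∈pq = trans (cong (if_then d else paint-pq z) (dec-false (z ≟ y) z≢y))
                                     (cong (if_then - d else c z) (dec-true (z ≟ p ⊎-dec z ≟ q) z∈pq))

    painted-p : painted p ≡ - d
    painted-p = painted-pq p (~⇒≢ (~-sym y~p)) (inj₁ refl)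

    painted-q : painted q ≡ - d
    painted-q = painted-pq q (~⇒≢ (~-sym y~q)) (inj₂ refl)

    painted-else : ∀ z → z ≢ y → z ≢ p → z ≢ q → painted z ≡ c z
    painted-else z z≢y z≢p z≢q = trans (cong (if_then d else paint-pq z) (dec-false (z ≟ y) z≢y))
      (cong (if_then - d else c z) (dec-false (z ≟ p ⊎-dec z ≟ q) [ z≢p , z≢q ]′))

    painted-extends : Extends c painted
    painted-extends z cz≢0 =
      painted-else z (λ { refl → cz≢0 cy≡0 }) (λ { refl → cz≢0 cp≡0 }) (λ { refl → cz≢0 cq≡0 })

    fewer-blanks : blanks painted ℕ.< blanks c
    fewer-blanks = blanks-decrease painted-extends y cy≡0 (d≢0 ∘ trans (sym painted-y))

    sat-p : Sat painted p
    sat-p = sat-opposite (~-sym y~p) (proj₂ (proj₂ ypq)) (d≢0 ∘ trans (sym painted-y))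
      (trans painted-q (cong -_ (sym painted-y)))

    sat-q : Sat painted q
    sat-q = sat-opposite (~-sym y~q) (~-sym (proj₂ (proj₂ ypq))) (d≢0 ∘ trans (sym painted-y))
      (trans painted-p (cong -_ (sym painted-y)))

    painted-sat : ∀ u → (c u ≢ 0ℤ → Sat c u) → painted u ≢ 0ℤ → u ≡ y ⊎ Sat painted u
    painted-sat u sat pu≢0 with u ≟ y | u ≟ p | u ≟ q
    ... | yes u≡y | _ | _ = inj₁ u≡y
    ... | no _ | yes refl | _ = inj₂ sat-p
    ... | no _ | no _ | yes refl = inj₂ sat-q
    ... | no u≢y | no u≢p | no u≢q =
      inj₂ (sat-extend painted-extends (sat pu≢0))

    painted-triangular : Triangular painted
    painted-triangular = record
      { in-triangle = in-triangle ∘ extends-≡0 painted-extends _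
      ; not-in-C4 = not-in-C4 ∘ extends-≡0 painted-extends _
      ; triangle-closed = closed
      }
      where
      ≢y : ∀ {v} → painted v ≡ 0ℤ → v ≢ y
      ≢y eq refl = d≢0 (trans (sym painted-y) eq)
      ≢p : ∀ {v} → painted v ≡ 0ℤ → v ≢ p
      ≢p eq refl = -d≢0 (trans (sym painted-p) eq)
      ≢q : ∀ {v} → painted v ≡ 0ℤ → v ≢ q
      ≢q eq refl = -d≢0 (trans (sym painted-q) eq)
      closed : ∀ {v r s} → painted v ≡ 0ℤ → Triangle v r s → painted r ≡ 0ℤ
      closed {v} {r} {s} eq vrs = trans (painted-else r r≢y r≢p r≢q) (triangle-closed (extends-≡0 painted-extends v eq) vrs)
        where
        -- Were `r` on the painted triangle, `triangle-unique` would put the uncoloured `v` on it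
        -- too.
        rvs : Triangle r v s
        rvs = let v~r , v~s , r~s = vrs in ~-sym v~r , r~s , v~s
        r≢y : r ≢ y
        r≢y refl = [ ≢p eq , ≢q eq ]′ (triangle-unique (not-in-C4 cy≡0) ypq rvs)
        r≢p : r ≢ p
        r≢p refl = [ ≢q eq , ≢y eq ]′ (triangle-unique (not-in-C4 cp≡0) (rotate ypq) rvs)
        r≢q : r ≢ q
        r≢q refl = [ ≢y eq , ≢p eq ]′ (triangle-unique (not-in-C4 cq≡0) (rotate (rotate ypq)) rvs)

  colour-triangles : ∀ m c → blanks c ℕ.< m → Triangular c → (∀ u → c u ≢ 0ℤ → Sat c u) →
    ∃ λ c′ → ∀ u → Sat c′ u
  colour-triangles (suc m) c (s≤s blanks≤m) triangular sat
    with any? (λ y → c y ≟ᶻ 0ℤ ×-dec any? (λ y′ → y ~? y′ ×-dec ¬? (c y′ ≟ᶻ 0ℤ)))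
  ... | yes (y , cy≡0 , y′ , y~y′ , cy′≢0) =
    let p , q , ypq = Triangular.in-triangle triangular cy≡0
        open Paint triangular ypq cy≡0 (c y′) cy′≢0
        -- The third neighbour `y′` supplies the colour that `p` and `q` do not have.
        sat-y : Sat painted y
        sat-y = sat-opposite y~y′ (proj₁ ypq) (extends-≢0 painted-extends y′ cy′≢0)
          (trans painted-p (cong -_ (sym (painted-extends y′ cy′≢0))))
    in colour-triangles m painted (ℕ.<-≤-trans fewer-blanks blanks≤m) painted-triangular
         (λ u pu≢0 → [ (λ u≡y → subst (Sat painted) (sym u≡y) sat-y) , id ]′ (painted-sat u (sat u) pu≢0))
  ... | no isolated with any? (λ x → c x ≟ᶻ 0ℤ)
  ... | no none = c , λ u → sat u (λ cu≡0 → none (u , cu≡0))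
  ... | yes (x , cx≡0) with Triangular.in-triangle triangular cx≡0
  ... | a , b , xab with third (proj₁ xab) (proj₁ (proj₂ xab)) (~⇒≢ (proj₂ (proj₂ xab)))
  -- No uncoloured vertex has a coloured neighbour here, so the neighbour `y` of `x` outside its
  -- triangle is uncoloured and has a triangle of its own.
  ... | y , x~y , y≢a , y≢b , _ =
    colour-triangles m P₂.painted (ℕ.<-≤-trans (ℕ.<-trans P₂.fewer-blanks P₁.fewer-blanks) blanks≤m)
      P₂.painted-triangular sat′
    where
    open Triangular triangular
    cy≡0 : c y ≡ 0ℤ
    cy≡0 = decidable-stable (c y ≟ᶻ 0ℤ) λ cy≢0 → isolated (x , cx≡0 , y , x~y , cy≢0)
    p q : Fin n
    p = proj₁ (in-triangle cy≡0)
    q = proj₁ (proj₂ (in-triangle cy≡0))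
    ypq : Triangle y p q
    ypq = proj₂ (proj₂ (in-triangle cy≡0))
    module P₁ = Paint triangular ypq cy≡0 1ℤ (λ ())
    y∉xab : ∀ {z} → ¬ Triangle x y z
    y∉xab xyz = [ y≢a , y≢b ]′ (triangle-unique (not-in-C4 cx≡0) xab xyz)
    x≢p : x ≢ p
    x≢p x≡p = let y~x , y~q , x~q = subst (λ z → Triangle y z q) (sym x≡p) ypq in y∉xab (x~y , x~q , y~q)
    x≢q : x ≢ q
    x≢q x≡q = let y~p , y~x , p~x = subst (Triangle y p) (sym x≡q) ypq in y∉xab (x~y , ~-sym p~x , y~p)
    -- A triangle on the edge `x y` would be a second one at `x`; hence painting the triangle of `y`
    -- leaves `x` blank.
    c₁x≡0 : P₁.painted x ≡ 0ℤ
    c₁x≡0 = trans (P₁.painted-else x (~⇒≢ x~y) x≢p x≢q) cx≡0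
    module P₂ = Paint P₁.painted-triangular xab c₁x≡0 1ℤ (λ ())
    c₂y≡1 : P₂.painted y ≡ 1ℤ
    c₂y≡1 = trans (P₂.painted-extends y (λ eq → contradiction (trans (sym P₁.painted-y) eq) λ ())) P₁.painted-y
    c₂p≡-1 : P₂.painted p ≡ - 1ℤ
    c₂p≡-1 = trans (P₂.painted-extends p (λ eq → contradiction (trans (sym P₁.painted-p) eq) λ ())) P₁.painted-p
    -- Both `x` and `y` have colour 1 and their triangle partners have -1, so each serves as the
    -- missing neighbour of the other.
    sat-x : Sat P₂.painted x
    sat-x = sat-opposite x~y (proj₁ xab) (λ eq → contradiction (trans (sym c₂y≡1) eq) λ ())
      (trans P₂.painted-p (cong -_ (sym c₂y≡1)))
    sat-y : Sat P₂.painted y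
    sat-y = sat-opposite (~-sym x~y) (proj₁ ypq) (λ eq → contradiction (trans (sym P₂.painted-y) eq) λ ())
      (trans c₂p≡-1 (cong -_ (sym P₂.painted-y)))
    sat′ : ∀ u → P₂.painted u ≢ 0ℤ → Sat P₂.painted u
    sat′ u c₂u≢0 = by-cases (u ≟ y)
      where
      by-cases : Dec (u ≡ y) → Sat P₂.painted u
      by-cases (yes u≡y) = subst (Sat P₂.painted) (sym u≡y) sat-y
      by-cases (no u≢y) = [ (λ u≡x → subst (Sat P₂.painted) (sym u≡x) sat-x) , id ]′
        (P₂.painted-sat u
          (λ c₁u≢0 → [ (λ u≡y → contradiction u≡y u≢y) , id ]′ (P₁.painted-sat u (sat u) c₁u≢0)) c₂u≢0)

  -- Use of L-freeness and assembly of the colouring.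

  -- The ball of radius two around `v` gives the tree: a child equal to a leaf of another child
  -- closes a triangle, and a leaf shared by two children closes a 4-cycle.
  no-short-cycle⇒L : ∀ v → ¬ InC4 v → ¬ InTriangle v → ContainsL G
  no-short-cycle⇒L v ¬c4 ¬tri =
    let a , b , c , v~a , v~b , v~c , a≢b , a≢c , b≢c , _ = cubic v
        a₁ , a₂ , a~a₁ , a~a₂ , a₁≢a₂ , a₁≢v , a₂≢v , _ = two-others (~-sym v~a)
        b₁ , b₂ , b~b₁ , b~b₂ , b₁≢b₂ , b₁≢v , b₂≢v , _ = two-others (~-sym v~b)
        c₁ , c₂ , c~c₁ , c~c₂ , c₁≢c₂ , c₁≢v , c₂≢v , _ = two-others (~-sym v~c)
        child≢leaf : ∀ {x y l} → v ~ x → v ~ y → y ~ l → x ≢ l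
        child≢leaf = λ { v~x v~y y~l refl → ¬tri (_ , _ , v~y , v~x , y~l) }
        leaf≢leaf : ∀ {x y l m} → v ~ x → v ~ y → x ≢ y → x ~ l → y ~ m → l ≢ v → l ≢ m
        leaf≢leaf = λ { v~x v~y x≢y x~l y~l l≢v refl →
          ¬c4 (_ , _ , _ , l≢v ∘ sym , x≢y , ~-sym v~x , x~l , ~-sym v~y , y~l) }
        unique = (~⇒≢ v~a ∷ ~⇒≢ v~b ∷ ~⇒≢ v~c ∷ a₁≢v ∘ sym ∷ a₂≢v ∘ sym ∷ b₁≢v ∘ sym ∷ b₂≢v ∘ sym ∷ c₁≢v ∘ sym ∷ c₂≢v ∘ sym ∷ [])
          ∷ (a≢b ∷ a≢c ∷ ~⇒≢ a~a₁ ∷ ~⇒≢ a~a₂ ∷ child≢leaf v~a v~b b~b₁ ∷ child≢leaf v~a v~b b~b₂ ∷ child≢leaf v~a v~c c~c₁ ∷ child≢leaf v~a v~c c~c₂ ∷ [])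
          ∷ (b≢c ∷ child≢leaf v~b v~a a~a₁ ∷ child≢leaf v~b v~a a~a₂ ∷ ~⇒≢ b~b₁ ∷ ~⇒≢ b~b₂ ∷ child≢leaf v~b v~c c~c₁ ∷ child≢leaf v~b v~c c~c₂ ∷ [])
          ∷ (child≢leaf v~c v~a a~a₁ ∷ child≢leaf v~c v~a a~a₂ ∷ child≢leaf v~c v~b b~b₁ ∷ child≢leaf v~c v~b b~b₂ ∷ ~⇒≢ c~c₁ ∷ ~⇒≢ c~c₂ ∷ [])
          ∷ (a₁≢a₂ ∷ leaf≢leaf v~a v~b a≢b a~a₁ b~b₁ a₁≢v ∷ leaf≢leaf v~a v~b a≢b a~a₁ b~b₂ a₁≢v
                   ∷ leaf≢leaf v~a v~c a≢c a~a₁ c~c₁ a₁≢v ∷ leaf≢leaf v~a v~c a≢c a~a₁ c~c₂ a₁≢v ∷ [])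
          ∷ (leaf≢leaf v~a v~b a≢b a~a₂ b~b₁ a₂≢v ∷ leaf≢leaf v~a v~b a≢b a~a₂ b~b₂ a₂≢v
                   ∷ leaf≢leaf v~a v~c a≢c a~a₂ c~c₁ a₂≢v ∷ leaf≢leaf v~a v~c a≢c a~a₂ c~c₂ a₂≢v ∷ [])
          ∷ (b₁≢b₂ ∷ leaf≢leaf v~b v~c b≢c b~b₁ c~c₁ b₁≢v ∷ leaf≢leaf v~b v~c b≢c b~b₁ c~c₂ b₁≢v ∷ [])
          ∷ (leaf≢leaf v~b v~c b≢c b~b₂ c~c₁ b₂≢v ∷ leaf≢leaf v~b v~c b≢c b~b₂ c~c₂ b₂≢v ∷ [])
          ∷ (c₁≢c₂ ∷ [])
          ∷ []
          ∷ []
    in lookup (v ∷ a ∷ b ∷ c ∷ a₁ ∷ a₂ ∷ b₁ ∷ b₂ ∷ c₁ ∷ c₂ ∷ []) ,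
       (λ {i} {j} → lookup-injective unique i j) ,
       λ { r-x1 → v~a ; r-x2 → v~b ; r-x3 → v~c
         ; x1-l1 → a~a₁ ; x1-l2 → a~a₂ ; x2-l3 → b~b₁ ; x2-l4 → b~b₂ ; x3-l5 → c~c₁ ; x3-l6 → c~c₂ }

  squares-coloured : ¬ ContainsL G → ∀ c → Good c → Closed c → (∀ z → c z ≡ 0ℤ → ¬ InC4 z) →
    Triangular c × (∀ u → c u ≢ 0ℤ → Sat c u)
  squares-coloured L-free c good closed no-C4 =
    record { in-triangle = tri ; not-in-C4 = no-C4 _ ; triangle-closed = tri-closed } ,
    λ u cu≢0 → [ (λ blank → contradiction (blank⇒≡0 u blank) cu≢0) , id ]′ (good u)
    where
    tri : ∀ {v} → c v ≡ 0ℤ → InTriangle v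
    tri {v} cv≡0 = decidable-stable (inTriangle? v) (λ ¬tri → L-free (no-short-cycle⇒L v (no-C4 v cv≡0) ¬tri))
    -- The clause of `q` contains both `v` and `p`.
    tri-closed : ∀ {v p q} → c v ≡ 0ℤ → Triangle v p q → c p ≡ 0ℤ
    tri-closed cv≡0 (v~p , v~q , p~q) = blank-lookup {c} (closed (~-sym v~q) cv≡0) (~-sym p~q)
    -- The uncoloured neighbour `n₁ u` has an uncoloured triangle partner, so its own clause is
    -- blank, and that clause contains `u`.
    blank⇒≡0 : ∀ u → Blank c u → c u ≡ 0ℤ
    blank⇒≡0 u (c₁≡0 , _) =
      let _ , _ , ypq = tri c₁≡0
      in blank-lookup {c} (closed (proj₁ ypq) (tri-closed c₁≡0 ypq)) (~-sym (~n₁ u))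

  sat-colouring : ¬ ContainsL G → ∃ λ c → ∀ u → Sat c u
  sat-colouring L-free =
    -- The start is the empty colouring, in which every clause is blank.
    let c , good , closed , no-C4 = colour-squares _ (λ _ → 0ℤ) ℕ.≤-refl (λ _ → inj₁ (refl , refl , refl))
        triangular , sat = squares-coloured L-free c good closed no-C4
    in colour-triangles _ c ℕ.≤-refl triangular sat

theorem2 : (n : ℕ) (G : Graph n) → Cubic G → ¬ ContainsL G → PartitionIntoTwoTDS G
theorem2 n G cubic L-free = part , dominating
  where
  open CubicGraph G cubic
  c : Colouring n
  c = proj₁ (sat-colouring L-free)
  part : Fin n → Fin 2
  -- A value 0, which `Sat` does not exclude, would fall into class `1F`; this is harmless because
  -- the witnesses have strict signs.
  part v = if does (0ℤ <? c v) then 0F else 1F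
  dominating : (k : Fin 2) (v : Fin n) → ∃ λ u → v ~ u × part u ≡ k
  dominating 0F v = let (p , v~p , 0<p) , _ = proj₂ (sat-colouring L-free) v
    in p , v~p , cong (if_then 0F else 1F) (dec-true (0ℤ <? c p) 0<p)
  dominating 1F v = let _ , (q , v~q , q<0) = proj₂ (sat-colouring L-free) v
    in q , v~q , cong (if_then 0F else 1F) (dec-false (0ℤ <? c q) (ℤ.<-asym q<0))
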